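{- For every integer $n\ge 4$ with $3\nmid n$, there exists a Universal Cycle for $3$-multisets of $[n]=\{1,\ldots,n\}$.
   Context: A Universal Cycle for $3$-multisets of $[n]$ is a cyclic sequence $a_1a_2\cdots a_k$ of $k=\binom{n+2}{3}$ entries from $[n]$ such that the $k$ multisets $\{a_i,a_{i+1},a_{i+2}\}$ ($i=1,\ldots,k$, indices taken cyclically modulo $k$) are pairwise distinct; equivalently, every $3$-multiset of $[n]$ appears exactly once as the multiset of $3$ cyclically consecutive entries. -}

module Defs where

open import Data.Nat using (ℕ; zero; suc; _+_; _%_)
open import Data.Nat.DivMod using (m%n<n)
open import Data.Product using (_×_)
open import Data.Nat.Combinatorics using (_C_)
open import Data.Fin using (Fin; toℕ; fromℕ<)
open import Data.List using (List; []; _∷_)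
open import Data.List.Relation.Binary.Permutation.Propositional using (_↭_)
open import Relation.Binary.PropositionalEquality using (_≡_)

next : {m : ℕ} → Fin (suc m) → Fin (suc m)
next {m} i = fromℕ< (m%n<n (suc (toℕ i)) (suc m))

-- the multiset {a_i, a_{i+1}, a_{i+2}} of a cyclic sequence, as a list
-- (compared up to permutation, i.e. as a multiset)
window : {m n : ℕ} → (Fin (suc m) → Fin n) → Fin (suc m) → List (Fin n)
window a i = a i ∷ a (next i) ∷ a (next (next i)) ∷ []

UniversalCycle3 : (n : ℕ) {m : ℕ} → (Fin (suc m) → Fin n) → Set
UniversalCycle3 n {m} a =
  (suc m ≡ (n + 2) C 3) × ((i j : Fin (suc m)) → window a i ↭ window a j → i ≡ j)

{-# OPTIONS --safe #-}

-- Work in ℤ/n.  A 3-multiset has cyclic differences p, q, r ≥ 0 with p + q + r = n, and since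
-- 3 ∤ n these are not all equal.  Leave out one of them by a rule that does not depend on
-- their order (the exceptional one if the other two are equal), say r, and traverse the
-- multiset as x, x + p, x + p + q: an edge (x, p) → (x + p, q) of a graph on pairs
-- (position, step).  The reflected class is traversed as x, x + q, x + q + p, so
-- (x, p, q) ↦ (x + p, q, p) is a permutation σ of the edges such that σ e starts where e ends.
-- Splicing the orbits of σ at common vertices gives an Euler circuit once the graph is
-- connected, and its sequence of positions is the universal cycle.  Connectivity comes from
-- (x, 0) → (x, 1) → (x + 1, 0), (x, 0) → (x, d) for 2d < n, and (x, 1) → (x + 1, n/2), the
-- last of which needs n ≥ 5.
module Submission where

open import Defs
open import Data.Nat using (ℕ; zero; suc; _+_; _*_; _∸_; _^_; _%_; _≤_; _<_; z≤n; s≤s; s≤s⁻¹; NonZero; >-nonZero; _≟_; _<?_)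
open import Data.Nat.Combinatorics using (_C_; k>n⇒nCk≡0; nCk+nC[k+1]≡[n+1]C[k+1])
open import Data.Nat.DivMod using (_mod_; m%n<n; m%n%n≡m%n; m<n⇒m%n≡m; n%n≡0; [m+n]%n≡m%n; %-distribˡ-+)
open import Data.Nat.Divisibility using (_∣_; divides)
open import Data.Nat.ListAction using (sum)
open import Data.Nat.ListAction.Properties using (sum-↭)
open import Data.Nat.Properties hiding (_≟_; _<?_)
open import Data.Nat.Tactic.RingSolver using (solve-∀)
open import Data.Fin using (Fin; zero; suc; toℕ; #_)
import Data.Fin.Properties as Fin
open import Data.Fin.Properties using (toℕ-fromℕ<; toℕ<n; toℕ-injective; all?)
open import Data.Vec using (Vec; []; _∷_)
import Data.Vec as Vec
import Data.Vec.Properties as Vec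
open import Data.List using (List; []; _∷_; _++_; length; map; lookup)
open import Data.List.Properties using (length-++; length-map; ++-assoc; ++-identityʳ; ∷-injective; ∷-injectiveˡ)
open import Data.List.Membership.Propositional using (_∈_; find; lose)
open import Data.List.Membership.Propositional.Properties using (∈-∃++; ∈-++⁺ˡ; ∈-++⁺ʳ; ∈-++⁻; ∈-map⁺; ∈-map⁻; ∈-lookup)
open import Data.List.Relation.Binary.Equality.Propositional using (≋⇒≡)
open import Data.List.Relation.Binary.Permutation.Propositional using (_↭_; prep; ↭-sym; ↭-trans; ↭-reflexive; ↭⇒↭ₛ; module PermutationReasoning)
import Data.List.Relation.Binary.Permutation.Propositional.Properties as Perm
open import Data.List.Relation.Binary.Permutation.Propositional.Properties using (∈-resp-↭; ↭-length; ++-comm; ++⁺ˡ; ++⁺ʳ; shift; shifts)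
import Data.List.Relation.Binary.Permutation.Setoid.Properties as SetoidPerm
open import Data.List.Relation.Unary.All using (All; []; _∷_)
open import Data.List.Relation.Unary.AllPairs using ([]; _∷_)
open import Data.List.Relation.Unary.Any using (any?; here; there)
open import Data.List.Relation.Unary.Linked using (Linked; [-]; _∷_)
open import Data.List.Relation.Unary.Sorted.TotalOrder.Properties using (↗↭↗⇒≋)
open import Data.List.Relation.Unary.Unique.Propositional using (Unique)
import Data.List.Relation.Unary.Unique.Propositional.Properties as Unique
open import Data.List.Relation.Unary.Unique.Propositional.Properties using (Unique[x∷xs]⇒x∉xs)
open import Data.Product using (∃; ∃₂; _×_; _,_; proj₁; proj₂)
open import Data.Product.Properties using (≡-dec; ,-injective; ,-injectiveˡ; ,-injectiveʳ)
open import Data.Sum using (_⊎_; inj₁; inj₂)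
open import Relation.Binary.Definitions using (DecidableEquality; tri<; tri≈; tri>)
open import Relation.Binary.PropositionalEquality using (_≡_; _≢_; refl; sym; trans; cong; cong₂; subst; subst₂; setoid; ≢-sym; module ≡-Reasoning)
open import Relation.Nullary using (¬_; Dec; yes; no; contradiction)
open import Relation.Nullary.Decidable using (_×-dec_; _⊎-dec_; _→-dec_; ¬?; from-yes)

-- Lists without repetitions

module _ {A : Set} where

  Unique-resp-↭ : {xs ys : List A} → xs ↭ ys → Unique xs → Unique ys
  Unique-resp-↭ p = SetoidPerm.Unique-resp-↭ (setoid A) (↭⇒↭ₛ p)

  Unique-++⁻ʳ : ∀ xs {ys : List A} → Unique (xs ++ ys) → Unique ys
  Unique-++⁻ʳ []       u       = u
  Unique-++⁻ʳ (x ∷ xs) (_ ∷ u) = Unique-++⁻ʳ xs u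

  Unique-++-disjoint : ∀ xs {ys : List A} {z} → Unique (xs ++ ys) → z ∈ xs → ¬ z ∈ ys
  Unique-++-disjoint (x ∷ xs) u       (here refl) z∈ys = Unique[x∷xs]⇒x∉xs u (∈-++⁺ʳ xs z∈ys)
  Unique-++-disjoint (x ∷ xs) (_ ∷ u) (there z∈)  z∈ys = Unique-++-disjoint xs u z∈ z∈ys

  lookup-injective : {xs : List A} → Unique xs → (i j : Fin (length xs)) →
                     lookup xs i ≡ lookup xs j → i ≡ j
  lookup-injective {_ ∷ _} _       zero    zero    _ = refl
  lookup-injective {_ ∷ _} u       zero    (suc j) eq =
    contradiction (subst (_∈ _) (sym eq) (∈-lookup j)) (Unique[x∷xs]⇒x∉xs u)
  lookup-injective {_ ∷ _} u       (suc i) zero    eq =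
    contradiction (subst (_∈ _) eq (∈-lookup i)) (Unique[x∷xs]⇒x∉xs u)
  lookup-injective {_ ∷ _} (_ ∷ u) (suc i) (suc j) eq = cong suc (lookup-injective u i j eq)

-- Injectivity is asked for only on members of the list, because `orientVec` is shown to be
-- injective only on vectors with sum below n.
map-unique : {A B : Set} {f : A → B} (xs : List A) →
             (∀ {x y} → x ∈ xs → y ∈ xs → f x ≡ f y → x ≡ y) →
             Unique xs → Unique (map f xs)
map-unique                 []       inj []        = []
map-unique {A} {B} {f} (x ∷ xs) inj u@(_ ∷ u′) =
  distinct xs (λ y∈ → y∈) ∷ map-unique xs (λ p q → inj (there p) (there q)) u′
  where
  distinct : ∀ ys → (∀ {y} → y ∈ ys → y ∈ xs) → All (f x ≢_) (map f ys)
  distinct []       sub = []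
  distinct (y ∷ ys) sub =
    (λ eq → Unique[x∷xs]⇒x∉xs u
      (subst (_∈ xs) (sym (inj (here refl) (there (sub (here refl))) eq)) (sub (here refl))))
    ∷ distinct ys (λ p → sub (there p))

-- Euler circuits

-- Where σ is injective on a finite set of edges that it preserves, it pairs incoming with outgoing
-- edges at each vertex; this takes the place of equal in- and out-degrees.
module Euler {A V : Set} (_≟ᴬ_ : DecidableEquality A) (_≟ⱽ_ : DecidableEquality V)
             (tail head : A → V) (σ : A → A) (σ-follows : ∀ e → head e ≡ tail (σ e)) where

  infixr 5 _∷_

  data Trail : V → List A → V → Set where
    []  : ∀ {v} → Trail v [] v
    _∷_ : ∀ {v e es w} → tail e ≡ v → Trail (head e) es w → Trail v (e ∷ es) w

  infixr 5 _++ᵀ_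

  _++ᵀ_ : ∀ {u v w xs ys} → Trail u xs v → Trail v ys w → Trail u (xs ++ ys) w
  []      ++ᵀ t = t
  (p ∷ s) ++ᵀ t = p ∷ (s ++ᵀ t)

  split : ∀ {u w} xs {e ys} → Trail u (xs ++ e ∷ ys) w →
          Trail u xs (tail e) × Trail (tail e) (e ∷ ys) w
  split []       (refl ∷ t) = [] , refl ∷ t
  split (x ∷ xs) (p ∷ t) with split xs t
  ... | t₁ , t₂ = p ∷ t₁ , t₂

  Trail-end : ∀ {u w e es} → Trail u (e ∷ es) w → (i : Fin (suc (length es))) →
              toℕ i ≡ length es → head (lookup (e ∷ es) i) ≡ w
  Trail-end {es = []}    (_ ∷ []) zero    _  = refl
  Trail-end {es = _ ∷ _} (_ ∷ t)  (suc i) eq = Trail-end t i (suc-injective eq)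

  Trail-step : ∀ {u w es} → Trail u es w → (i j : Fin (length es)) → toℕ j ≡ suc (toℕ i) →
               head (lookup es i) ≡ tail (lookup es j)
  Trail-step (_ ∷ (q ∷ _)) zero    (suc zero) _  = sym q
  Trail-step (_ ∷ t)       (suc i) (suc j)    eq = Trail-step t i j (suc-injective eq)

  -- Closedness matters only at the last index, where `next` wraps round to zero.
  Trail-next : ∀ {v e es} → Trail v (e ∷ es) v → (i : Fin (suc (length es))) →
               head (lookup (e ∷ es) i) ≡ tail (lookup (e ∷ es) (next i))
  Trail-next {es = es} t i with m≤n⇒m<n∨m≡n (toℕ<n i)
  ... | inj₁ lt = Trail-step t i (next i) (trans (toℕ-fromℕ< _) (m<n⇒m%n≡m lt))
  Trail-next {e = e} {es} t@(start ∷ _) i | inj₂ eq =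
    trans (Trail-end t i (suc-injective eq))
      (trans (sym start) (cong (λ j → tail (lookup (e ∷ es) j)) (sym wrap)))
    where
    wrap : next i ≡ zero
    wrap = toℕ-injective (trans (toℕ-fromℕ< _)
      (trans (cong (_% suc (length es)) eq) (n%n≡0 (suc (length es)))))

  Stable : List A → Set
  Stable xs = ∀ {e} → e ∈ xs → σ e ∈ xs

  Injective-on : List A → Set
  Injective-on xs = ∀ {e f} → e ∈ xs → f ∈ xs → σ e ≡ σ f → e ≡ f

  -- The field `onto`, together with injectivity, is what keeps `rest` stable once the orbit is
  -- removed.
  record Orbit (f : A) (es : List A) : Set where
    field
      orbit rest : List A
      partition  : orbit ++ rest ↭ es
      closed     : Trail (tail f) orbit (tail f)
      start      : f ∈ orbit
      stable     : Stable orbit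
      onto       : ∀ {y} → y ∈ orbit → ∃ λ z → z ∈ orbit × y ≡ σ z

  module _ {es : List A} (unique : Unique es) (es-stable : Stable es) (inj : Injective-on es) where

    -- The iterates f, σ f, … , e of f are exactly the elements of e ∷ P; by injectivity the
    -- first one to be repeated is f itself.
    private
      extend : ∀ f k e P R → length R ≤ k → e ∷ P ++ R ↭ es → Trail (tail f) P (tail e) →
               (∀ {y} → y ∈ e ∷ P → y ≡ f ⊎ ∃ λ z → z ∈ P × y ≡ σ z) →
               (∀ {y} → y ∈ P → σ y ∈ e ∷ P) → f ∈ e ∷ P → Orbit f es
      extend f k e P R |R|≤k perm t from into f∈ with σ e ≟ᴬ f
      ... | yes σe≡f = record
        { orbit     = P ++ e ∷ []
        ; rest      = R
        ; partition = ↭-trans (++⁺ʳ R rotate) perm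
        ; closed    = t ++ᵀ (refl ∷ subst (λ v → Trail v [] (tail f))
                                         (trans (cong tail (sym σe≡f)) (sym (σ-follows e))) [])
        ; start     = ∈-resp-↭ (↭-sym rotate) f∈
        ; stable    = λ y∈ → ∈-resp-↭ (↭-sym rotate) (stable (∈-resp-↭ rotate y∈))
        ; onto      = λ y∈ → onto (from (∈-resp-↭ rotate y∈))
        }
        where
        rotate : P ++ e ∷ [] ↭ e ∷ P
        rotate = ++-comm P (e ∷ [])
        stable : ∀ {y} → y ∈ e ∷ P → σ y ∈ e ∷ P
        stable (here refl) = subst (_∈ e ∷ P) (sym σe≡f) f∈
        stable (there y∈P) = into y∈P
        onto : ∀ {y} → y ≡ f ⊎ ∃ (λ z → z ∈ P × y ≡ σ z) → ∃ λ z → z ∈ P ++ e ∷ [] × y ≡ σ z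
        onto (inj₁ y≡f)             = e , ∈-++⁺ʳ P (here refl) , trans y≡f (sym σe≡f)
        onto (inj₂ (z , z∈P , y≡σz)) = z , ∈-++⁺ˡ z∈P , y≡σz
      -- If σ e has been visited, then, not being f, it is σ z for some z in P; injectivity gives e
      -- = z, against uniqueness.
      ... | no σe≢f with ∈-++⁻ (e ∷ P) (∈-resp-↭ (↭-sym perm) (es-stable (∈-resp-↭ perm (here refl))))
      ... | inj₁ σe∈ with from σe∈
      ...   | inj₁ σe≡f = contradiction σe≡f σe≢f
      ...   | inj₂ (z , z∈P , σe≡σz) = contradiction
        (subst (_∈ P ++ R)
          (sym (inj (∈-resp-↭ perm (here refl)) (∈-resp-↭ perm (there (∈-++⁺ˡ z∈P))) σe≡σz))
          (∈-++⁺ˡ z∈P))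
        (Unique[x∷xs]⇒x∉xs (Unique-resp-↭ (↭-sym perm) unique))
      extend f k e P R |R|≤k perm t from into f∈ | no σe≢f | inj₂ σe∈R with ∈-∃++ σe∈R
      -- The bound k drives the recursion; it cannot be zero here, since R contains σ e.
      extend f zero e P _ |R|≤k perm t from into f∈ | no _ | inj₂ _ | R₁ , R₂ , refl =
        contradiction (subst (_≤ 0) (↭-length (shift (σ e) R₁ R₂)) |R|≤k) λ ()
      extend f (suc k) e P _ |R|≤k perm t from into f∈ | no _ | inj₂ _ | R₁ , R₂ , refl =
        extend f k (σ e) (P ++ e ∷ []) (R₁ ++ R₂)
          (s≤s⁻¹ (subst (_≤ suc k) (↭-length (shift (σ e) R₁ R₂)) |R|≤k))
          perm′
          (t ++ᵀ (refl ∷ subst (λ v → Trail v [] (tail (σ e))) (sym (σ-follows e)) []))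
          from′ into′ (there (∈-resp-↭ (↭-sym rotate) f∈))
        where
        rotate : P ++ e ∷ [] ↭ e ∷ P
        rotate = ++-comm P (e ∷ [])
        perm′ : σ e ∷ (P ++ e ∷ []) ++ R₁ ++ R₂ ↭ es
        perm′ = begin
          σ e ∷ (P ++ e ∷ []) ++ R₁ ++ R₂   ↭⟨ prep _ (++⁺ʳ (R₁ ++ R₂) rotate) ⟩
          σ e ∷ e ∷ P ++ R₁ ++ R₂           ↭⟨ shift (σ e) (e ∷ P) (R₁ ++ R₂) ⟨
          e ∷ P ++ σ e ∷ R₁ ++ R₂           ↭⟨ ++⁺ˡ (e ∷ P) (shift (σ e) R₁ R₂) ⟨
          e ∷ P ++ R₁ ++ σ e ∷ R₂           ↭⟨ perm ⟩
          es                                ∎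
          where open PermutationReasoning
        from′ : ∀ {y} → y ∈ σ e ∷ P ++ e ∷ [] → y ≡ f ⊎ ∃ λ z → z ∈ P ++ e ∷ [] × y ≡ σ z
        from′ (here refl) = inj₂ (e , ∈-++⁺ʳ P (here refl) , refl)
        from′ (there y∈) with from (∈-resp-↭ rotate y∈)
        ... | inj₁ y≡f             = inj₁ y≡f
        ... | inj₂ (z , z∈P , eq) = inj₂ (z , ∈-++⁺ˡ z∈P , eq)
        into′ : ∀ {y} → y ∈ P ++ e ∷ [] → σ y ∈ σ e ∷ P ++ e ∷ []
        into′ y∈ with ∈-resp-↭ rotate y∈
        ... | here refl = here refl
        ... | there y∈P = there (∈-resp-↭ (↭-sym rotate) (into y∈P))

    orbit-of : ∀ {f} → f ∈ es → Orbit f es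
    orbit-of {f} f∈ with ∈-∃++ f∈
    ... | R₁ , R₂ , refl = extend f (length (R₁ ++ R₂)) f [] (R₁ ++ R₂) ≤-refl
      (↭-sym (shift f R₁ R₂)) [] (λ { (here refl) → inj₁ refl ; (there ()) }) (λ ()) (here refl)

  -- Connectivity takes the form of an induction principle: a set of edges containing e₀ and closed
  -- under σ and under sharing a tail is everything. `splice` applies it to the edges already in the
  -- circuit.
  module _ {es : List A} (unique : Unique es) (es-stable : Stable es) (inj : Injective-on es)
           {e₀ : A} (e₀∈ : e₀ ∈ es)
           (connected : (S : A → Set) → S e₀ → (∀ {e} → e ∈ es → S e → S (σ e)) →
                        (∀ {e f} → f ∈ es → S e → tail e ≡ tail f → S f) →
                        ∀ {f} → f ∈ es → S f) where

    private
      -- If σ e fell into O, it would be σ z with z in O, and injectivity would put e itself into O.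
      rest-stable : ∀ {O R us} → Unique us → Injective-on us → Stable us → O ++ R ↭ us →
                    (∀ {y} → y ∈ O → ∃ λ z → z ∈ O × y ≡ σ z) → Stable R
      rest-stable {O} {R} {us} u i s perm onto {e} e∈R
        with ∈-++⁻ O (∈-resp-↭ (↭-sym perm) (s (∈-resp-↭ perm (∈-++⁺ʳ O e∈R))))
      ... | inj₂ σe∈R = σe∈R
      ... | inj₁ σe∈O with onto σe∈O
      ...   | z , z∈O , eq = contradiction e∈R (Unique-++-disjoint O (Unique-resp-↭ (↭-sym perm) u)
        (subst (_∈ O) (sym (i (∈-resp-↭ perm (∈-++⁺ʳ O e∈R)) (∈-resp-↭ perm (∈-++⁺ˡ z∈O)) eq)) z∈O))

      splice : ∀ {v} k L U → length U ≤ k → L ++ U ↭ es → Trail v L v →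
               Stable L → Stable U → e₀ ∈ L → ∃ λ L′ → L′ ↭ es × Trail v L′ v
      splice {v} k L U |U|≤k perm t L-stable U-stable e₀∈L
        with any? (λ f → any? (λ e → tail e ≟ⱽ tail f) L) U
      ... | no none = L , subst (_↭ es) (++-identityʳ L) (subst (λ xs → L ++ xs ↭ es) (empty U none∈) perm) , t
        where
        all∈ : ∀ {f} → f ∈ es → f ∈ L
        all∈ = connected (_∈ L) e₀∈L (λ _ → L-stable) same-tail
          where
          same-tail : ∀ {e f} → f ∈ es → e ∈ L → tail e ≡ tail f → f ∈ L
          same-tail f∈ e∈L eq with ∈-++⁻ L (∈-resp-↭ (↭-sym perm) f∈)
          ... | inj₁ f∈L = f∈L
          ... | inj₂ f∈U = contradiction (lose f∈U (lose e∈L eq)) none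
        none∈ : ∀ {f} → ¬ f ∈ U
        none∈ f∈U = Unique-++-disjoint L (Unique-resp-↭ (↭-sym perm) unique)
                      (all∈ (∈-resp-↭ perm (∈-++⁺ʳ L f∈U))) f∈U
        empty : ∀ xs → (∀ {f} → ¬ f ∈ xs) → xs ≡ []
        empty []      _ = refl
        empty (x ∷ _) h = contradiction (here refl) h
      ... | yes some with find some
      ...   | f , f∈U , some′ with find some′
      ...     | e , e∈L , te≡tf with ∈-∃++ e∈L
      splice {v} zero L [] |U|≤k perm t L-stable U-stable e₀∈L
        | yes _ | f , () , _ | e , e∈L , te≡tf | L₁ , L₂ , refl
      splice {v} zero L (_ ∷ _) () perm t L-stable U-stable e₀∈L
        | yes _ | f , _ , _ | e , e∈L , te≡tf | L₁ , L₂ , refl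
      splice {v} (suc k) _ U |U|≤k perm t L-stable U-stable e₀∈L
        | yes _ | f , f∈U , _ | e , e∈L , te≡tf | L₁ , L₂ , refl =
        splice k (L₁ ++ orbit ++ e ∷ L₂) rest (s≤s⁻¹ (≤-trans shorter |U|≤k))
          perm′
          -- The orbit is a closed trail at tail f = tail e, so it fits in just before e.
          (proj₁ (split L₁ t) ++ᵀ subst (λ w → Trail w orbit w) (sym te≡tf) closed ++ᵀ proj₂ (split L₁ t))
          (λ y∈ → ∈-resp-↭ (↭-sym insert) (L′-stable (∈-++⁻ orbit (∈-resp-↭ insert y∈))))
          (rest-stable U-unique U-inj U-stable partition onto)
          (∈-resp-↭ (↭-sym insert) (∈-++⁺ʳ orbit e₀∈L))
        where
        L : List A
        L = L₁ ++ e ∷ L₂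
        U⊆ : ∀ {y} → y ∈ U → y ∈ es
        U⊆ y∈ = ∈-resp-↭ perm (∈-++⁺ʳ L y∈)
        U-unique : Unique U
        U-unique = Unique-++⁻ʳ L (Unique-resp-↭ (↭-sym perm) unique)
        U-inj : Injective-on U
        U-inj x∈ y∈ = inj (U⊆ x∈) (U⊆ y∈)
        -- Taking the orbit inside U, which is stable, makes it disjoint from L.
        open Orbit (orbit-of U-unique U-stable U-inj f∈U)
        insert : L₁ ++ orbit ++ e ∷ L₂ ↭ orbit ++ L
        insert = shifts L₁ orbit
        shorter : suc (length rest) ≤ length U
        shorter = subst (suc (length rest) ≤_)
          (trans (sym (length-++ orbit)) (↭-length partition))
          (+-monoˡ-≤ (length rest) (nonempty start))
          where
          nonempty : ∀ {xs : List A} {x} → x ∈ xs → 1 ≤ length xs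
          nonempty {_ ∷ _} _ = s≤s z≤n
        L′-stable : ∀ {y} → y ∈ orbit ⊎ y ∈ L → σ y ∈ orbit ++ L
        L′-stable (inj₁ y∈) = ∈-++⁺ˡ (stable y∈)
        L′-stable (inj₂ y∈) = ∈-++⁺ʳ orbit (L-stable y∈)
        perm′ : (L₁ ++ orbit ++ e ∷ L₂) ++ rest ↭ es
        perm′ = begin
          (L₁ ++ orbit ++ e ∷ L₂) ++ rest   ↭⟨ ++⁺ʳ rest insert ⟩
          (orbit ++ L) ++ rest              ↭⟨ ++⁺ʳ rest (++-comm orbit L) ⟩
          (L ++ orbit) ++ rest              ≡⟨ ++-assoc L orbit rest ⟩
          L ++ orbit ++ rest                ↭⟨ ++⁺ˡ L partition ⟩
          L ++ U                            ↭⟨ perm ⟩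
          es                                ∎
          where open PermutationReasoning

    euler-circuit : ∃₂ λ v L → L ↭ es × Trail v L v
    euler-circuit = tail e₀ , splice (length rest) orbit rest ≤-refl partition closed stable
        (rest-stable unique inj es-stable partition onto) start
      where open Orbit (orbit-of unique es-stable inj e₀∈)

-- Vectors of naturals with bounded sum

incr-head : ∀ {k} → Vec ℕ (suc k) → Vec ℕ (suc k)
incr-head (x ∷ xs) = suc x ∷ xs

-- The bound on the sum is strict. Splitting on whether the first entry is zero mirrors Pascal's
-- rule. For k = 3 the vectors (a, p, q) encode the multisets a ≤ a + p ≤ a + p + q < n.
boundedSum : (k n : ℕ) → List (Vec ℕ k)
boundedSum k       zero    = []
boundedSum zero    (suc n) = [] ∷ []
boundedSum (suc k) (suc n) = map (0 ∷_) (boundedSum k (suc n)) ++ map incr-head (boundedSum (suc k) n)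

length-boundedSum : ∀ k n → length (boundedSum k (suc n)) ≡ (n + k) C k
length-boundedSum zero    n = refl
length-boundedSum (suc k) n = begin
  length (map (0 ∷_) (boundedSum k (suc n)) ++ map incr-head (boundedSum (suc k) n))
    ≡⟨ length-++ (map (0 ∷_) (boundedSum k (suc n))) ⟩
  length (map (0 ∷_) (boundedSum k (suc n))) + length (map incr-head (boundedSum (suc k) n))
    ≡⟨ cong₂ _+_ (length-map _ (boundedSum k (suc n))) (length-map _ (boundedSum (suc k) n)) ⟩
  length (boundedSum k (suc n)) + length (boundedSum (suc k) n)
    ≡⟨ cong₂ _+_ (length-boundedSum k n) (length′ n) ⟩
  (n + k) C k + (n + k) C suc k
    ≡⟨ nCk+nC[k+1]≡[n+1]C[k+1] (n + k) k ⟩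
  suc (n + k) C suc k
    ≡⟨ cong (_C suc k) (+-suc n k) ⟨
  (n + suc k) C suc k ∎
  where
  open ≡-Reasoning
  -- Bound 0 is a separate case: the empty list matches k C (k + 1) = 0.
  length′ : ∀ n → length (boundedSum (suc k) n) ≡ (n + k) C suc k
  length′ zero    = sym (k>n⇒nCk≡0 (n<1+n k))
  length′ (suc n) = trans (length-boundedSum (suc k) n) (cong (_C suc k) (+-suc n k))

incr-head-injective : ∀ {k} {v w : Vec ℕ (suc k)} → incr-head v ≡ incr-head w → v ≡ w
incr-head-injective {v = _ ∷ _} {_ ∷ _} refl = refl

unique-boundedSum : ∀ k n → Unique (boundedSum k n)
unique-boundedSum k       zero    = []
unique-boundedSum zero    (suc n) = [] ∷ []
unique-boundedSum (suc k) (suc n) =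
  Unique.++⁺ (Unique.map⁺ {f = 0 ∷_} Vec.∷-injectiveʳ (unique-boundedSum k (suc n)))
      (Unique.map⁺ incr-head-injective (unique-boundedSum (suc k) n)) disjoint
  where
  disjoint : ∀ {v} → ¬ (v ∈ map (0 ∷_) (boundedSum k (suc n)) × v ∈ map incr-head (boundedSum (suc k) n))
  disjoint (p , q) with ∈-map⁻ (0 ∷_) p | ∈-map⁻ incr-head q
  ... | _ , _ , refl | (_ ∷ _) , _ , ()

∈-boundedSum⁺ : ∀ k n (v : Vec ℕ k) → Vec.sum v < n → v ∈ boundedSum k n
∈-boundedSum⁺ zero    (suc n) []          _  = here refl
∈-boundedSum⁺ (suc k) (suc n) (zero ∷ v)  lt =
  ∈-++⁺ˡ (∈-map⁺ (0 ∷_) (∈-boundedSum⁺ k (suc n) v lt))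
∈-boundedSum⁺ (suc k) (suc n) (suc x ∷ v) lt =
  ∈-++⁺ʳ (map (0 ∷_) (boundedSum k (suc n)))
    (∈-map⁺ incr-head (∈-boundedSum⁺ (suc k) n (x ∷ v) (s≤s⁻¹ lt)))

∈-boundedSum⁻ : ∀ k n {v : Vec ℕ k} → v ∈ boundedSum k n → Vec.sum v < n
∈-boundedSum⁻ zero    (suc n) (here refl) = s≤s z≤n
∈-boundedSum⁻ (suc k) (suc n) v∈ with ∈-++⁻ (map (0 ∷_) (boundedSum k (suc n))) v∈
... | inj₁ p with ∈-map⁻ (0 ∷_) p
...   | w , w∈ , refl = ∈-boundedSum⁻ k (suc n) w∈
∈-boundedSum⁻ (suc k) (suc n) v∈ | inj₂ q with ∈-map⁻ incr-head q
...   | (_ ∷ _) , w∈ , refl = s≤s (∈-boundedSum⁻ (suc k) n w∈)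

-- The transition graph

+-rotate : ∀ p q r → q + r + p ≡ p + q + r
+-rotate = solve-∀

-- (x , d , d′) stands for the window x, x + d, x + d + d′ modulo n, an edge from (x , d) to
-- (x + d , d′).
Edge Vertex : Set
Edge   = ℕ × ℕ × ℕ
Vertex = ℕ × ℕ

module Differences (n : ℕ) .{{_ : NonZero n}} (5≤n : 5 ≤ n) (3∤n : ¬ 3 ∣ n) where

  -- Apart from the multisets with two equal differences, the largest difference is left out;
  -- ranking n/2 lowest keeps it as a step, which connects it to the rest of the graph.
  key : ℕ → ℕ
  key d with d + d ≟ n
  ... | yes _ = 0
  ... | no  _ = suc d

  key-half : ∀ {d} → d + d ≡ n → key d ≡ 0
  key-half {d} eq with d + d ≟ n
  ... | yes _  = refl
  ... | no neq = contradiction eq neq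

  key-other : ∀ {d} → d + d ≢ n → key d ≡ suc d
  key-other {d} neq with d + d ≟ n
  ... | yes eq = contradiction eq neq
  ... | no _   = refl

  double-injective : ∀ {c d} → c + c ≡ d + d → c ≡ d
  double-injective {c} {d} eq with <-cmp c d
  ... | tri< c<d _ _ = contradiction eq (<⇒≢ (+-mono-< c<d c<d))
  ... | tri≈ _ c≡d _ = c≡d
  ... | tri> _ _ d<c = contradiction (sym eq) (<⇒≢ (+-mono-< d<c d<c))

  -- Only n/2 has rank 0, so distinct differences never tie.
  key-injective : ∀ {c d} → key c ≡ key d → c ≡ d
  key-injective {c} {d} eq with c + c ≟ n | d + d ≟ n
  ... | yes p | yes q = double-injective (trans p (sym q))
  ... | no  _ | no _  = suc-injective eq

  -- Omit p q r: a multiset with cyclic differences p, q, r is traversed by the steps p, q.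
  Omit : ℕ → ℕ → ℕ → Set
  Omit p q r = p ≡ q ⊎ (p ≢ q × key p < key r × key q < key r)

  omit? : ∀ p q r → Dec (Omit p q r)
  omit? p q r = (p ≟ q) ⊎-dec (¬? (p ≟ q) ×-dec ((key p <? key r) ×-dec (key q <? key r)))

  Omit-sym : ∀ {p q r} → Omit p q r → Omit q p r
  Omit-sym (inj₁ p≡q)             = inj₁ (sym p≡q)
  Omit-sym (inj₂ (p≢q , p<r , q<r)) = inj₂ ((λ q≡p → p≢q (sym q≡p)) , q<r , p<r)

  -- The two failures give p ≠ q and q ≠ r. If also r ≠ p, the ranks are distinct and the difference
  -- of largest rank is left out; it is neither r nor p, so it is q.
  Omit-exists : ∀ p q r → ¬ Omit p q r → ¬ Omit q r p → Omit r p q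
  Omit-exists p q r ¬pq ¬qr with r ≟ p
  ... | yes r≡p = inj₁ r≡p
  ... | no  r≢p = inj₂ (r≢p , r<q , p<q)
    where
    p≢q : p ≢ q
    p≢q p≡q = ¬pq (inj₁ p≡q)
    q≢r : q ≢ r
    q≢r q≡r = ¬qr (inj₁ q≡r)
    key-compare : ∀ {c d} → c ≢ d → key c < key d ⊎ key d < key c
    key-compare {c} {d} c≢d with <-cmp (key c) (key d)
    ... | tri< lt _ _ = inj₁ lt
    ... | tri≈ _ eq _ = contradiction (key-injective eq) c≢d
    ... | tri> _ _ gt = inj₂ gt
    r<q : key r < key q
    r<q with key-compare (≢-sym q≢r) | key-compare p≢q | key-compare r≢p
    ... | inj₁ lt | _ | _ = lt
    ... | inj₂ q<r | _ | inj₂ p<r = contradiction (inj₂ (p≢q , p<r , q<r)) ¬pq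
    ... | inj₂ q<r | _ | inj₁ r<p = contradiction (inj₂ (q≢r , <-trans q<r r<p , r<p)) ¬qr
    p<q : key p < key q
    p<q with key-compare p≢q | key-compare r≢p
    ... | inj₁ lt | _ = lt
    ... | inj₂ q<p | inj₁ r<p = contradiction (inj₂ (q≢r , q<p , r<p)) ¬qr
    ... | inj₂ q<p | inj₂ p<r = contradiction (inj₂ (p≢q , p<r , <-trans q<p p<r)) ¬pq

  -- Two equal pairs would make all three differences equal and n divisible by 3; the other
  -- combinations contradict the order of the ranks. The remaining rotations follow by `+-rotate`.
  Omit-unique : ∀ {p q r} → p + q + r ≡ n → Omit p q r → ¬ Omit q r p
  Omit-unique {p} sum≡ (inj₁ refl) (inj₁ refl) = 3∤n (divides p (trans (sym sum≡) (triple p)))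
    where
    triple : ∀ p → p + p + p ≡ p * 3
    triple = solve-∀
  Omit-unique sum≡ (inj₁ refl)          (inj₂ (_ , q<p , _)) = <-irrefl refl q<p
  Omit-unique sum≡ (inj₂ (_ , _ , q<r)) (inj₁ refl)          = <-irrefl refl q<r
  Omit-unique sum≡ (inj₂ (_ , p<r , _)) (inj₂ (_ , _ , r<p)) = <-asym p<r r<p

  -- This bounds the vertices that connectivity has to reach. A step p is n/2, or equals the other
  -- step, or is smaller than r, so that 2p ≤ p + r.
  Omit⇒half : ∀ {p q r} → p + q + r ≡ n → Omit p q r → p + p ≤ n
  Omit⇒half {p} {q} {r} sum≡ (inj₁ refl) = subst (p + p ≤_) sum≡ (m≤m+n (p + p) r)
  Omit⇒half {p} {q} {r} sum≡ (inj₂ (_ , p<r , _)) with p + p ≟ n | r + r ≟ n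
  ... | yes eq | _ = ≤-reflexive eq
  ... | no _   | no _ = subst (p + p ≤_) sum≡ (+-mono-≤ (m≤m+n p q) (<⇒≤ (s≤s⁻¹ p<r)))

  -- The edge of the multiset {a, a + p, a + p + q}, where r = n − p − q.
  orient : ℕ → ℕ → ℕ → ℕ → Edge
  orient a p q r with omit? p q r | omit? q r p
  ... | yes _ | _     = a , p , q
  ... | no  _ | yes _ = a + p , q , r
  ... | no  _ | no  _ = a + p + q , r , p

  orient₁ : ∀ {a p q r} → Omit p q r → orient a p q r ≡ (a , p , q)
  orient₁ {a} {p} {q} {r} o with omit? p q r
  ... | yes _ = refl
  ... | no ¬o = contradiction o ¬o

  -- By `Omit-unique` the earlier test in `orient` cannot succeed; likewise for `orient₃`.
  orient₂ : ∀ {a p q r} → p + q + r ≡ n → Omit q r p → orient a p q r ≡ (a + p , q , r)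
  orient₂ {a} {p} {q} {r} sum≡ o with omit? p q r | omit? q r p
  ... | yes o′ | _     = contradiction o (Omit-unique sum≡ o′)
  ... | no _   | yes _ = refl
  ... | no _   | no ¬o = contradiction o ¬o

  orient₃ : ∀ {a p q r} → p + q + r ≡ n → Omit r p q → orient a p q r ≡ (a + p + q , r , p)
  orient₃ {a} {p} {q} {r} sum≡ o with omit? p q r | omit? q r p
  ... | yes o′ | _     = contradiction o′ (Omit-unique (trans (sym (+-rotate r p q)) sum≡) o)
  ... | no _   | yes o′ = contradiction o (Omit-unique (trans (+-rotate p q r) sum≡) o′)
  ... | no _   | no _ = refl

  -- Addition modulo n

  infixl 6 _⊕_

  _⊕_ : ℕ → ℕ → ℕ
  x ⊕ d = (x + d) % n

  ⊕-< : ∀ x d → x + d < n → x ⊕ d ≡ x + d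
  ⊕-< x d = m<n⇒m%n≡m

  ⊕-wrap : ∀ x d {y} → x + d ≡ y + n → y < n → x ⊕ d ≡ y
  ⊕-wrap x d {y} eq y<n = trans (cong (_% n) eq) (trans ([m+n]%n≡m%n y n) (m<n⇒m%n≡m y<n))

  ⊕-assoc : ∀ x d d′ → (x ⊕ d) ⊕ d′ ≡ x ⊕ (d + d′)
  ⊕-assoc x d d′ = begin
    ((x + d) % n + d′) % n             ≡⟨ %-distribˡ-+ ((x + d) % n) d′ n ⟩
    ((x + d) % n % n + d′ % n) % n     ≡⟨ cong (λ y → (y + d′ % n) % n) (m%n%n≡m%n (x + d) n) ⟩
    ((x + d) % n + d′ % n) % n         ≡⟨ %-distribˡ-+ (x + d) d′ n ⟨
    (x + d + d′) % n                   ≡⟨ cong (_% n) (+-assoc x d d′) ⟩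
    (x + (d + d′)) % n                 ∎
    where open ≡-Reasoning

  ⊕-inverse : ∀ {x d d′} → x < n → d + d′ ≡ n → (x ⊕ d) ⊕ d′ ≡ x
  ⊕-inverse {x} {d} {d′} x<n eq = trans (⊕-assoc x d d′) (⊕-wrap x (d + d′) (cong (x +_) eq) x<n)

  ⊕-cancelʳ : ∀ {x y d} → x < n → y < n → d ≤ n → x ⊕ d ≡ y ⊕ d → x ≡ y
  ⊕-cancelʳ {x} {y} {d} x<n y<n d≤n eq = begin
    x                    ≡⟨ ⊕-inverse x<n (m+[n∸m]≡n d≤n) ⟨
    (x ⊕ d) ⊕ (n ∸ d)    ≡⟨ cong (_⊕ (n ∸ d)) eq ⟩
    (y ⊕ d) ⊕ (n ∸ d)    ≡⟨ ⊕-inverse y<n (m+[n∸m]≡n d≤n) ⟩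
    y                    ∎
    where open ≡-Reasoning

  -- Edges and the multisets they traverse

  Good : Edge → Set
  Good (x , d , d′) = x < n × ∃ λ r → d + d′ + r ≡ n × Omit d d′ r

  values : Edge → List ℕ
  values (x , d , d′) = x ∷ x ⊕ d ∷ x ⊕ d ⊕ d′ ∷ []

  sorted : ℕ → ℕ → ℕ → List ℕ
  sorted a p q = a ∷ a + p ∷ a + p + q ∷ []

  module _ (a p q r : ℕ) (sum≡ : p + q + r ≡ n) (lt : a + p + q < n) where

    private
      a+p<n : a + p < n
      a+p<n = ≤-<-trans (m≤m+n (a + p) q) lt
      a<n : a < n
      a<n = ≤-<-trans (m≤m+n a p) a+p<n
      wrap : ∀ a p q r → a + p + q + r ≡ a + (p + q + r)
      wrap = solve-∀
      wrap′ : a + p + q ⊕ r ≡ a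
      wrap′ = ⊕-wrap (a + p + q) r (trans (wrap a p q r) (cong (a +_) sum≡)) a<n

    orient-good : Good (orient a p q r)
    orient-good with omit? p q r | omit? q r p
    ... | yes o | _     = a<n , r , sum≡ , o
    ... | no  _ | yes o = a+p<n , p , trans (+-rotate p q r) sum≡ , o
    ... | no ¬o | no ¬o′ = lt , q , trans (sym (+-rotate r p q)) sum≡ , Omit-exists p q r ¬o ¬o′

    -- The three differences add up to n, so walking along a rotation of them visits the same
    -- residues from another starting point.
    values-orient : values (orient a p q r) ↭ sorted a p q
    values-orient with omit? p q r | omit? q r p
    ... | yes _ | _ = ↭-reflexive (cong (a ∷_) (cong₂ (λ y z → y ∷ z ∷ [])
                        (⊕-< a p a+p<n) (trans (cong (_⊕ q) (⊕-< a p a+p<n)) (⊕-< (a + p) q lt))))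
    ... | no  _ | yes _ = ↭-trans
      (↭-reflexive (cong (a + p ∷_) (cong₂ (λ y z → y ∷ z ∷ [])
        (⊕-< (a + p) q lt) (trans (cong (_⊕ r) (⊕-< (a + p) q lt)) wrap′))))
      (++-comm (a + p ∷ a + p + q ∷ []) (a ∷ []))
    ... | no  _ | no _ = ↭-trans
      (↭-reflexive (cong (a + p + q ∷_) (cong₂ (λ y z → y ∷ z ∷ [])
        wrap′ (trans (cong (_⊕ p) wrap′) (⊕-< a p a+p<n)))))
      (++-comm (a + p + q ∷ []) (a ∷ a + p ∷ []))

  sorted-↗ : ∀ a p q → Linked _≤_ (sorted a p q)
  sorted-↗ a p q = m≤m+n a p ∷ m≤m+n (a + p) q ∷ [-]

  sorted-unique : ∀ {a p q a′ p′ q′} → sorted a p q ↭ sorted a′ p′ q′ → sorted a p q ≡ sorted a′ p′ q′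
  sorted-unique {a} {p} {q} {a′} {p′} {q′} perm =
    ≋⇒≡ (↗↭↗⇒≋ ≤-totalOrder (sorted-↗ a p q) (sorted-↗ a′ p′ q′) (↭⇒↭ₛ perm))

  sorted-injective : ∀ {a p q a′ p′ q′} → sorted a p q ≡ sorted a′ p′ q′ → (a ≡ a′) × (p ≡ p′) × (q ≡ q′)
  sorted-injective {a} {p} {q} {a′} {p′} {q′} eq
    with refl , eq′ ← ∷-injective eq
    with eq₁ , eq″ ← ∷-injective eq′
    with refl ← +-cancelˡ-≡ a p p′ eq₁
    with refl ← +-cancelˡ-≡ (a + p) q q′ (∷-injectiveˡ eq″) = refl , refl , refl

  orientVec : Vec ℕ 3 → Edge
  orientVec (a ∷ p ∷ q ∷ []) = orient a p q (n ∸ (p + q))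

  edges : List Edge
  edges = map orientVec (boundedSum 3 n)

  private
    vec-bound : ∀ {a p q} → (a ∷ p ∷ q ∷ []) ∈ boundedSum 3 n → (p + q + (n ∸ (p + q)) ≡ n) × (a + p + q < n)
    vec-bound {a} {p} {q} v∈ = m+[n∸m]≡n (≤-trans (m≤n+m (p + q) a) (<⇒≤ lt′)) , subst (_< n) (sym (+-assoc a p q)) lt′
      where
      lt′ : a + (p + q) < n
      lt′ = subst (λ y → a + (p + y) < n) (+-identityʳ q) (∈-boundedSum⁻ 3 n v∈)

  orientVec-good : ∀ v → v ∈ boundedSum 3 n → Good (orientVec v)
  orientVec-good (a ∷ p ∷ q ∷ []) v∈ = orient-good a p q (n ∸ (p + q)) (proj₁ (vec-bound v∈)) (proj₂ (vec-bound v∈))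

  -- With `good∈edges` this describes the edge set by `Good` alone, so σ and connectivity can be
  -- treated without `orient`.
  edges-good : ∀ {e} → e ∈ edges → Good e
  edges-good e∈ = let v , v∈ , eq = ∈-map⁻ orientVec e∈ in subst Good (sym eq) (orientVec-good v v∈)

  -- The values rearrange the sorted list a, a + p, a + p + q, which is determined by the multiset
  -- and gives back a, p, q as first entry and successive differences.
  values-injective : ∀ v w → v ∈ boundedSum 3 n → w ∈ boundedSum 3 n →
                     values (orientVec v) ↭ values (orientVec w) → v ≡ w
  values-injective (a ∷ p ∷ q ∷ []) (a′ ∷ p′ ∷ q′ ∷ []) v∈ w∈ perm =
    let a≡ , p≡ , q≡ = sorted-injective (sorted-unique {a} {p} {q} {a′} {p′} {q′}
          (↭-trans (↭-sym (values-orient a p q (n ∸ (p + q)) (proj₁ (vec-bound v∈)) (proj₂ (vec-bound v∈))))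
            (↭-trans perm (values-orient a′ p′ q′ (n ∸ (p′ + q′)) (proj₁ (vec-bound w∈)) (proj₂ (vec-bound w∈))))))
    in cong₂ _∷_ a≡ (cong₂ _∷_ p≡ (cong (_∷ []) q≡))

  edges-unique : Unique edges
  edges-unique = map-unique (boundedSum 3 n)
    (λ {v} {w} v∈ w∈ eq → values-injective v w v∈ w∈ (↭-reflexive (cong values eq))) (unique-boundedSum 3 n)

  edges-injective : ∀ {e f} → e ∈ edges → f ∈ edges → values e ↭ values f → e ≡ f
  edges-injective e∈ f∈ perm =
    let v , v∈ , e≡ = ∈-map⁻ orientVec e∈
        w , w∈ , f≡ = ∈-map⁻ orientVec f∈
    in trans e≡ (trans (cong orientVec (values-injective v w v∈ w∈
         (subst₂ (λ e f → values e ↭ values f) e≡ f≡ perm))) (sym f≡))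

  orient∈edges : ∀ {a p q r} → p + q + r ≡ n → a + p + q < n → orient a p q r ∈ edges
  orient∈edges {a} {p} {q} {r} sum≡ lt =
    subst (λ s → orient a p q s ∈ edges) (trans (cong (_∸ (p + q)) (sym sum≡)) (m+n∸m≡n (p + q) r))
      (∈-map⁺ orientVec (∈-boundedSum⁺ 3 n (a ∷ p ∷ q ∷ [])
        (subst (_< n) (trans (+-assoc a p q) (cong (λ y → a + (p + y)) (sym (+-identityʳ q)))) lt)))

  -- The three cases say how many of the two steps pass through 0 modulo n.
  good∈edges : ∀ {e} → Good e → e ∈ edges
  good∈edges {x , d , d′} (x<n , r , sum≡ , o) with x + d <? n | x + d + d′ <? n
  ... | _ | yes lt = subst (_∈ edges) (orient₁ o) (orient∈edges sum≡ lt)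
  -- The last entry is now the least: the multiset in order is y, y + r = x, x + d.
  ... | yes x+d<n | no ≮n = subst (_∈ edges) eq (orient∈edges sum′ (subst (_< n) (sym (cong (_+ d) y+r≡x)) x+d<n))
    where
    y : ℕ
    y = x + d + d′ ∸ n
    y+n≡ : y + n ≡ x + d + d′
    y+n≡ = m∸n+n≡m (≮⇒≥ ≮n)
    y+r≡x : y + r ≡ x
    y+r≡x = +-cancelʳ-≡ (d + d′) (y + r) x (trans (shuffle y r d d′) (trans (cong (y +_) sum≡) (trans y+n≡ (+-assoc x d d′))))
      where
      shuffle : ∀ y r d d′ → y + r + (d + d′) ≡ y + (d + d′ + r)
      shuffle = solve-∀
    sum′ : r + d + d′ ≡ n
    sum′ = trans (sym (+-rotate r d d′)) sum≡
    eq : orient y r d d′ ≡ (x , d , d′)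
    eq = trans (orient₂ sum′ o) (cong (λ z → z , d , d′) y+r≡x)
  -- The middle entry is now the least: the multiset in order is y, y + d′, y + d′ + r = x.
  ... | no ≮n | no _ = subst (_∈ edges) eq (orient∈edges sum′ (subst (_< n) (sym y+d′+r≡x) x<n))
    where
    y : ℕ
    y = x + d ∸ n
    y+n≡ : y + n ≡ x + d
    y+n≡ = m∸n+n≡m (≮⇒≥ ≮n)
    y+d′+r≡x : y + d′ + r ≡ x
    y+d′+r≡x = +-cancelʳ-≡ d (y + d′ + r) x (trans (shuffle y r d d′) (trans (cong (y +_) sum≡) y+n≡))
      where
      shuffle : ∀ y r d d′ → y + d′ + r + d ≡ y + (d + d′ + r)
      shuffle = solve-∀
    sum′ : d′ + r + d ≡ n
    sum′ = trans (+-rotate d d′ r) sum≡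
    eq : orient y d′ r d ≡ (x , d , d′)
    eq = trans (orient₃ sum′ o) (cong (λ z → z , d , d′) y+d′+r≡x)

  -- The permutation σ

  tail head : Edge → Vertex
  tail (x , d , _)  = x , d
  head (x , d , d′) = x ⊕ d , d′

  σ : Edge → Edge
  σ (x , d , d′) = x ⊕ d , d′ , d

  -- The rule for leaving out a difference ignores the order of the other two; this is why σ stays
  -- inside the graph.
  Good-swap : ∀ {x d d′} → Good (x , d , d′) → Good (x , d′ , d)
  Good-swap {x} {d} {d′} (x<n , r , sum≡ , o) =
    x<n , r , trans (cong (_+ r) (+-comm d′ d)) sum≡ , Omit-sym o

  σ-good : ∀ {e} → Good e → Good (σ e)
  σ-good {x , d , _} (_ , g) = Good-swap (m%n<n (x + d) n , g)

  σ-injective : ∀ {e f} → Good e → Good f → σ e ≡ σ f → e ≡ f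
  σ-injective {x , d , d′} {y , c , c′} (x<n , r , sum≡ , _) (y<n , _) eq
    with ,-injective (,-injectiveʳ eq)
  ... | refl , refl = cong (λ z → z , d , d′) (⊕-cancelʳ x<n y<n d≤n (,-injectiveˡ eq))
    where
    d≤n : d ≤ n
    d≤n = subst (d ≤_) sum≡ (≤-trans (m≤m+n d d′) (m≤m+n (d + d′) r))

  open Euler (≡-dec _≟_ (≡-dec _≟_ _≟_)) (≡-dec _≟_ _≟_) tail head σ (λ _ → refl)


  -- Connectivity of the transition graph

  n≢0 : 0 ≢ n
  n≢0 0≡n with () ← subst (5 ≤_) (sym 0≡n) 5≤n

  -- For d > 0 the third difference n - d exceeds both 0 and d and is not n/2, so it has the largest
  -- rank; for d = 0 there is an equal pair.
  Omit-0 : ∀ {d} → d + d < n → Omit 0 d (n ∸ d)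
  Omit-0 {zero}      _ = inj₁ refl
  Omit-0 {d@(suc _)} d+d<n = inj₂ ((λ ()) , subst₂ _<_ (sym (key-other n≢0)) (sym key-r) (s≤s (≤-<-trans z≤n d<r))
                                         , subst₂ _<_ (sym (key-other (<⇒≢ d+d<n))) (sym key-r) (s≤s d<r))
    where
    d<r : d < n ∸ d
    d<r = m+n≤o⇒m≤o∸n (suc d) d+d<n
    d+r≡n : d + (n ∸ d) ≡ n
    d+r≡n = m+[n∸m]≡n (≤-trans (m≤m+n d d) (<⇒≤ d+d<n))
    key-r : key (n ∸ d) ≡ suc (n ∸ d)
    key-r = key-other (λ eq → <⇒≢ (+-monoˡ-< (n ∸ d) d<r) (trans d+r≡n (sym eq)))

  -- Here n/2 is h + 1. Since n/2 ranks lowest, h is left out as soon as it exceeds 1, which is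
  -- where n ≥ 5 enters.
  Omit-1 : ∀ {h} → suc h + suc h ≡ n → Omit 1 (suc h) h
  Omit-1 {h} eq = inj₂ (1≢1+h , subst₂ _<_ (sym (key-other 2≢n)) (sym key-h) (s≤s 2≤h)
                              , subst₂ _<_ (sym (key-half eq)) (sym key-h) (s≤s z≤n))
    where
    2≤h : 2 ≤ h
    2≤h = half-bound h (subst (5 ≤_) (sym eq) 5≤n)
      where
      half-bound : ∀ h → 5 ≤ suc h + suc h → 2 ≤ h
      half-bound 0             (s≤s (s≤s ()))
      half-bound 1             (s≤s (s≤s (s≤s (s≤s ()))))
      half-bound (suc (suc _)) _ = s≤s (s≤s z≤n)
    1≢1+h : 1 ≢ suc h
    1≢1+h eq′ = <⇒≢ (s≤s (≤-trans (s≤s z≤n) 2≤h)) eq′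
    2≢n : 2 ≢ n
    2≢n eq′ with s≤s (s≤s ()) ← subst (5 ≤_) (sym eq′) 5≤n
    key-h : key h ≡ suc h
    key-h = key-other (λ eq′ → <⇒≢ (+-mono-< (n<1+n h) (n<1+n h)) (trans eq′ (sym eq)))

  module _ (S : Edge → Set) (S₀ : S (0 , 0 , 0))
           (S-σ : ∀ {e} → e ∈ edges → S e → S (σ e))
           (S-tail : ∀ {e f} → f ∈ edges → S e → tail e ≡ tail f → S f) where

    private
      Full : Vertex → Set
      Full v = ∀ {e} → e ∈ edges → tail e ≡ v → S e

      -- By `S-tail` one edge of S at a vertex brings in all others there, so a single edge carries
      -- fullness along.
      full-step : ∀ {x d d′} → Good (x , d , d′) → Full (x , d) → Full (x ⊕ d , d′)
      full-step g full e∈ eq = S-tail e∈ (S-σ (good∈edges g) (full (good∈edges g) refl)) (sym eq)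

      0-good : ∀ {x d} → x < n → d + d < n → Good (x , 0 , d)
      0-good {x} {d} x<n d+d<n =
        x<n , n ∸ d , m+[n∸m]≡n (≤-trans (m≤m+n d d) (<⇒≤ d+d<n)) , Omit-0 d+d<n

      x⊕0≡x : ∀ {x} → x < n → x ⊕ 0 ≡ x
      x⊕0≡x {x} x<n = trans (cong (_% n) (+-identityʳ x)) (m<n⇒m%n≡m x<n)

      2<n : 2 < n
      2<n = ≤-trans (s≤s (s≤s (s≤s z≤n))) 5≤n

      from-0 : ∀ {x d} → x < n → d + d < n → Full (x , 0) → Full (x , d)
      from-0 {x} {d} x<n d+d<n full =
        subst (λ y → Full (y , d)) (x⊕0≡x x<n) (full-step (0-good x<n d+d<n) full)

      full-0 : ∀ x → x < n → Full (x , 0)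
      full-0 zero    _   e∈ eq = S-tail e∈ S₀ (sym eq)
      full-0 (suc x) x<n = subst (λ y → Full (y , 0)) (trans (⊕-< x 1 (subst (_< n) (+-comm 1 x) x<n)) (+-comm x 1))
        -- From (x, 0) to (x, 1), then along the swapped edge (x, 1, 0) to (x + 1, 0).
        (full-step (Good-swap (0-good x<n′ 2<n)) (from-0 x<n′ 2<n (full-0 x x<n′)))
        where
        x<n′ : x < n
        x<n′ = <-trans (n<1+n x) x<n

      full : ∀ {x d} → x < n → d + d ≤ n → Full (x , d)
      full {x} {d} x<n d+d≤n with d + d ≟ n
      ... | no neq = from-0 x<n (≤∧≢⇒< d+d≤n neq) (full-0 x x<n)
      full {x} {zero}  x<n _ | yes eq = contradiction eq n≢0
      full {x} {suc h} x<n _ | yes eq =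
        subst (λ y → Full (y , suc h)) y⊕1≡x
          (full-step (y<n , h , trans (suc+ h) eq , Omit-1 eq) (from-0 y<n 2<n (full-0 y y<n)))
        where
        suc+ : ∀ h → 1 + suc h + h ≡ suc h + suc h
        suc+ = solve-∀
        y : ℕ
        -- The predecessor of x modulo n: the vertex (x, n/2) is entered from (x - 1, 1).
        y = x ⊕ (n ∸ 1)
        y<n : y < n
        y<n = m%n<n (x + (n ∸ 1)) n
        y⊕1≡x : y ⊕ 1 ≡ x
        y⊕1≡x = ⊕-inverse x<n (m∸n+n≡m (<⇒≤ (≤-trans (s≤s (s≤s z≤n)) 5≤n)))

    edges-connected : ∀ {f} → f ∈ edges → S f
    edges-connected f∈ with edges-good f∈
    ... | x<n , r , sum≡ , o = full x<n (Omit⇒half sum≡ o) f∈ refl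

  -- The universal cycle for n ≥ 5

  loop∈edges : (0 , 0 , 0) ∈ edges
  loop∈edges = good∈edges (≤-trans (s≤s z≤n) 5≤n , n , refl , inj₁ refl)

  circuit : ∃₂ λ v L → L ↭ edges × Trail v L v
  circuit = euler-circuit edges-unique (λ e∈ → good∈edges (σ-good (edges-good e∈)))
    (λ e∈ f∈ → σ-injective (edges-good e∈) (edges-good f∈))
    loop∈edges edges-connected

  length-edges : length edges ≡ (n + 2) C 3
  length-edges = trans (length-map orientVec (boundedSum 3 n)) (length-boundedSum₃ n)
    where
    length-boundedSum₃ : ∀ n .{{_ : NonZero n}} → length (boundedSum 3 n) ≡ (n + 2) C 3
    length-boundedSum₃ (suc k) = trans (length-boundedSum 3 k) (cong (_C 3) (+-suc k 2))

  universalCycle : ∃ λ m → ∃ λ (a : Fin (suc m) → Fin n) → UniversalCycle3 n a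
  universalCycle with circuit
  ... | v , []     , perm , _ with () ← ∈-resp-↭ (↭-sym perm) loop∈edges
  ... | v , e ∷ es , perm , t = length es , a , trans (↭-length perm) length-edges , distinct
    where
    edge : Fin (suc (length es)) → Edge
    edge = lookup (e ∷ es)
    -- Positions of edges are already below n, so `mod` only changes the type.
    a : Fin (suc (length es)) → Fin n
    a i = proj₁ (edge i) mod n
    edge∈ : ∀ i → edge i ∈ edges
    edge∈ i = ∈-resp-↭ perm (∈-lookup i)
    toℕ-a : ∀ i → toℕ (a i) ≡ proj₁ (edge i)
    toℕ-a i = trans (toℕ-fromℕ< _) (m<n⇒m%n≡m (proj₁ (edges-good (edge∈ i))))
    step : ∀ i → head (edge i) ≡ tail (edge (next i))
    step = Trail-next t
    toℕ-window : ∀ i → map toℕ (window a i) ≡ values (edge i)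
    -- Consecutive edges agree in both position and step, so the third entry of the window is
    -- reached by the second step of edge i.
    toℕ-window i = cong₂ _∷_ (toℕ-a i) (cong₂ (λ y z → y ∷ z ∷ [])
      (trans (toℕ-a (next i)) (sym (,-injectiveˡ (step i))))
      (trans (toℕ-a (next (next i))) (trans (sym (,-injectiveˡ (step (next i))))
        (sym (cong₂ _⊕_ (,-injectiveˡ (step i)) (,-injectiveʳ (step i)))))))
    distinct : ∀ i j → window a i ↭ window a j → i ≡ j
    distinct i j w = lookup-injective (Unique-resp-↭ (↭-sym perm) edges-unique) i j
      (edges-injective (edge∈ i) (edge∈ j)
        (subst₂ _↭_ (toℕ-window i) (toℕ-window j) (Perm.map⁺ toℕ w)))

-- The case n = 4

cycle₄ : Vec (Fin 4) 20
cycle₄ = # 0 ∷ # 0 ∷ # 0 ∷ # 1 ∷ # 1 ∷ # 1 ∷ # 2 ∷ # 0 ∷ # 2 ∷ # 0 ∷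
         # 3 ∷ # 1 ∷ # 3 ∷ # 1 ∷ # 2 ∷ # 2 ∷ # 2 ∷ # 3 ∷ # 3 ∷ # 3 ∷ []

-- An explicit cycle is given because for n = 4 the differences 1, 1, 2 leave out 2: step 2 occurs
-- only in the edges (x, 2, 2), and the graph is disconnected.
universalCycle₄ : UniversalCycle3 4 (Vec.lookup cycle₄)
universalCycle₄ = refl , λ i j w → code-injective i j (sum-↭ (Perm.map⁺ (λ x → 4 ^ toℕ x) w))
  where
  -- In base 4 the digits of the code are the multiplicities of the multiset.
  code : Fin 20 → ℕ
  code i = sum (map (λ x → 4 ^ toℕ x) (window (Vec.lookup cycle₄) i))
  code-injective : ∀ i j → code i ≡ code j → i ≡ j
  code-injective = from-yes (all? λ i → all? λ j → (code i ≟ code j) →-dec (i Fin.≟ j))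

theorem8 : (n : ℕ) → 4 ≤ n → ¬ (3 ∣ n) →
    ∃ λ m → ∃ λ (a : Fin (suc m) → Fin n) → UniversalCycle3 n a
theorem8 n 4≤n 3∤n with m≤n⇒m<n∨m≡n 4≤n
... | inj₂ refl = 19 , Vec.lookup cycle₄ , universalCycle₄
... | inj₁ 5≤n  = universalCycle
  where open Differences n {{>-nonZero (≤-trans (s≤s z≤n) 5≤n)}} 5≤n 3∤n
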